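{- Let $n\ge 2$ and let $G_n$ be the $n\times n$ matrix whose $(p,q)$ entry is $2^{q-p+1}$ if $q\ge p$, $2$ if $q=p-1$, and $0$ if $q<p-1$. Let $x=(x_{n-1},x_{n-2},\ldots,x_{0})^{\top}$ be an eigenvector of $G_n$ associated to an eigenvalue $\lambda$. Then for all $i=1,\dots,n-1$, $$x_{i} = \left(-\frac{1}{2}\right)^{i}g_{i}(\lambda)x_{0},$$ where $g_{i}(\lambda)$ is the characteristic polynomial of the $i\times i$ matrix $G_{i}$.
   Context: The characteristic polynomial of an $i\times i$ matrix $G_i$ is $\det(G_i-\lambda I)$. The matrix $G_i$ is defined by the same entry formula with size $i$. The entries of $x$ are indexed in decreasing order, so $x_0$ is the last entry. -}

module Defs where

open import Algebra.Apartness.Bundles using (HeytingCommutativeRing; HeytingField)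
open import Algebra.Bundles using (CommutativeRing)
import Algebra.Properties.Monoid.Sum
import Algebra.Properties.Semiring.Exp
open import Data.Bool.Base using (if_then_else_)
open import Data.Fin.Base using (Fin; zero; suc; toℕ; fromℕ<; opposite; punchIn)
open import Data.Fin.Properties using () renaming (_≟_ to _≟ᶠ_)
open import Data.Nat.Base as ℕ using (ℕ; zero; suc; _∸_)
open import Data.Nat.Properties using (_≤?_; _≟_)
open import Data.Product.Base using (_×_; proj₁)
open import Data.Vec.Functional using (Vector)
open import Level using (Level)
open import Relation.Nullary.Decidable.Core using (does)
open import Relation.Nullary.Negation.Core using (¬_)

-- The stdlib has neither ℝ nor ℂ, so everything is over a field; Heyting
-- fields are the constructive notion of which both are instances.
module Matrices {c ℓ₁ ℓ₂ : Level} (K : HeytingField c ℓ₁ ℓ₂) where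

  open HeytingField K hiding (zero)
  open HeytingCommutativeRing heytingCommutativeRing using (commutativeRing)
  open CommutativeRing commutativeRing using (semiring; +-monoid)
  open Algebra.Properties.Monoid.Sum +-monoid using (sum-syntax) public
  open Algebra.Properties.Semiring.Exp semiring using (_^_) public

  Matrix : ℕ → ℕ → Set c
  Matrix m n = Fin m → Fin n → Carrier

  2# : Carrier
  2# = 1# + 1#

  -- #⇒invertible inverts 2# - 0#, which is ≈ 2#.
  ½ : 2# # 0# → Carrier
  ½ 2#0 = proj₁ (#⇒invertible 2#0)

  _·_ : ∀ {m n} → Matrix m n → Vector Carrier n → Vector Carrier m
  _·_ {n = n} A x p = ∑[ q < n ] (A p q * x q)

  -- Laplace expansion along the first column.
  det : ∀ {n} → Matrix n n → Carrier
  det {zero}  A = 1#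
  det {suc n} A =
    ∑[ p < suc n ] ((- 1#) ^ toℕ p * (A p zero * det (λ i j → A (punchIn p i) (suc j))))

  I : ∀ {n} → Matrix n n
  I p q = if does (p ≟ᶠ q) then 1# else 0#

  -- The sign convention is det (A - μ I), so the leading coefficient is (-1)ⁿ.
  charPoly : ∀ {n} → Matrix n n → Carrier → Carrier
  charPoly A μ = det (λ p q → A p q - μ * I p q)

  IsEigenvector : ∀ {n} → Matrix n n → Carrier → Vector Carrier n → Set _
  IsEigenvector A μ x = ¬ (∀ p → x p ≈ 0#) × (∀ p → (A · x) p ≈ μ * x p)

  -- Indices start at 0; only the difference of row and column matters.
  G : ∀ n → Matrix n n
  G n p q = entry (toℕ p) (toℕ q)
    where
    entry : ℕ → ℕ → Carrier
    entry p q =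
      if does (p ≤? q) then 2# ^ (q ∸ p ℕ.+ 1)
      else if does (p ≟ suc q) then 2#
      else 0#

  -- x = (xₙ₋₁, …, x₁, x₀)ᵀ: the coordinate xᵢ stands at 0-based position n-1-i.
  coord : ∀ {n} → Vector Carrier n → (i : ℕ) → .(i ℕ.< n) → Carrier
  coord x i i<n = x (opposite (fromℕ< i<n))

{-# OPTIONS --safe #-}

-- Only the rows of (Gₙ - μI) x = 0 below the first are needed to express x
-- through its last entry x₀. More generally, let A be an upper Hessenberg
-- matrix with constant subdiagonal b, of size n + 1, and let x be annihilated
-- by all rows of A but the first. With v = -1/b and A′ the matrix A without its
-- first row and column, x's first entry is vⁿ det A′ x₀, and row 0 of A x is
-- vⁿ det A x₀. Both follow by a simultaneous induction: only two terms of the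
-- Laplace expansion along the first column survive, and both minors are again
-- Hessenberg and annihilate the tail of x. The corollary is the first formula,
-- applied to the last i + 1 entries of x, since Gₙ is Toeplitz.
module Submission where

open import Defs
open import Algebra.Apartness.Bundles using (HeytingCommutativeRing; HeytingField)
open import Algebra.Bundles using (CommutativeRing)
import Algebra.Properties.Ring
import Algebra.Properties.Semiring.Sum
import Algebra.Solver.Ring.NaturalCoefficients.Default
open import Data.Fin.Base using (Fin; zero; suc; toℕ; fromℕ; fromℕ<; inject₁; opposite; punchIn)
open import Data.Fin.Properties using (toℕ-fromℕ<; toℕ-injective; opposite-prop)
open import Data.Nat.Base
  using (ℕ; zero; suc; _∸_; z≤n; z<s; s<s; s≤s⁻¹)
  renaming (_≤_ to _≤ℕ_; _<_ to _<ℕ_)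
open import Data.Nat.Properties using (≤-<-trans; +-∸-assoc; n∸n≡0; m<1+n⇒m<n∨m≡n)
open import Data.Product.Base using (_×_; _,_; proj₁; proj₂)
open import Data.Sum.Base using (inj₁; inj₂)
open import Data.Vec.Functional using (Vector; tail)
open import Function.Base using (_∘_)
open import Level using (Level)
open import Relation.Binary.PropositionalEquality as ≡ using (_≡_)
import Relation.Binary.Reasoning.Setoid

-- Coordinates counted from the end

opposite-fromℕ<-max : ∀ {n} (n<1+n : n <ℕ suc n) → opposite (fromℕ< n<1+n) ≡ zero
opposite-fromℕ<-max {n} n<1+n = toℕ-injective (begin
  toℕ (opposite (fromℕ< n<1+n))  ≡⟨ opposite-prop (fromℕ< n<1+n) ⟩
  n ∸ toℕ (fromℕ< n<1+n)         ≡⟨ ≡.cong (n ∸_) (toℕ-fromℕ< n<1+n) ⟩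
  n ∸ n                          ≡⟨ n∸n≡0 n ⟩
  0                              ∎)
  where open ≡.≡-Reasoning

-- An index counted from the end does not change when the first entry is dropped; this identifies
-- `coord x i` with `coord (tail x) i`.
opposite-fromℕ<-suc : ∀ {i n} (i<n : i <ℕ n) (i<1+n : i <ℕ suc n) →
                      opposite (fromℕ< i<1+n) ≡ suc (opposite (fromℕ< i<n))
opposite-fromℕ<-suc {i} {suc n} i<n i<1+n = toℕ-injective (begin
  toℕ (opposite (fromℕ< i<1+n))      ≡⟨ opposite-prop (fromℕ< i<1+n) ⟩
  suc n ∸ toℕ (fromℕ< i<1+n)         ≡⟨ ≡.cong (suc n ∸_) (toℕ-fromℕ< i<1+n) ⟩
  suc n ∸ i                          ≡⟨ +-∸-assoc 1 (s≤s⁻¹ i<n) ⟩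
  suc (n ∸ i)                        ≡⟨ ≡.cong (λ k → suc (n ∸ k)) (toℕ-fromℕ< i<n) ⟨
  suc (n ∸ toℕ (fromℕ< i<n))         ≡⟨ ≡.cong suc (opposite-prop (fromℕ< i<n)) ⟨
  suc (toℕ (opposite (fromℕ< i<n)))  ∎)
  where open ≡.≡-Reasoning

module _ {c ℓ₁ ℓ₂ : Level} (K : HeytingField c ℓ₁ ℓ₂) where

  open HeytingField K using (heytingCommutativeRing; _#_; #⇒invertible)
  open HeytingCommutativeRing heytingCommutativeRing using (commutativeRing)
  open CommutativeRing commutativeRing hiding (zero)
  open Algebra.Properties.Ring ring
  open Algebra.Properties.Semiring.Sum semiring
    using (sum; sum-cong-≋; sum-replicate-zero; ∑-distrib-+; *-distribˡ-sum)
  open Algebra.Solver.Ring.NaturalCoefficients.Default commutativeSemiring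
    using (solve; _:=_; _:+_; _:*_; con)
  open Relation.Binary.Reasoning.Setoid setoid
  open Matrices K

  -- Determinants and linear systems of Hessenberg matrices

  sum-zero : ∀ {n} {t : Vector Carrier n} → (∀ p → t p ≈ 0#) → sum t ≈ 0#
  sum-zero {n} t≈0 = trans (sum-cong-≋ t≈0) (sum-replicate-zero n)

  det-cong : ∀ {n} {A B : Matrix n n} → (∀ p q → A p q ≈ B p q) → det A ≈ det B
  det-cong {zero}  A≈B = refl
  det-cong {suc n} A≈B = sum-cong-≋ λ p →
    *-congˡ {(- 1#) ^ toℕ p} (*-cong (A≈B p zero) (det-cong λ i j → A≈B (punchIn p i) (suc j)))

  minor : ∀ {n} → Matrix (suc n) (suc n) → Fin (suc n) → Matrix n n
  minor A p i j = A (punchIn p i) (suc j)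

  record IsHessenberg (b : Carrier) {n} (A : Matrix (suc n) (suc n)) : Set ℓ₁ where
    field
      subdiagonal : ∀ p → A (suc p) (inject₁ p) ≈ b
      below       : ∀ p q → suc (toℕ q) <ℕ toℕ p → A p q ≈ 0#

  open IsHessenberg

  minor₀-isHessenberg : ∀ {b n} {A : Matrix (suc (suc n)) (suc (suc n))} →
                        IsHessenberg b A → IsHessenberg b (minor A zero)
  minor₀-isHessenberg H .subdiagonal p = H .subdiagonal (suc p)
  minor₀-isHessenberg H .below p q q<p = H .below (suc p) (suc q) (s<s q<p)

  -- Below its first row this minor agrees with `minor A zero`. Its first row comes from row zero of
  -- `A`, and `IsHessenberg` puts no condition on a first row.
  minor₁-isHessenberg : ∀ {b n} {A : Matrix (suc (suc n)) (suc (suc n))} →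
                        IsHessenberg b A → IsHessenberg b (minor A (suc zero))
  minor₁-isHessenberg H .subdiagonal p = H .subdiagonal (suc p)
  minor₁-isHessenberg H .below (suc p) q q<p = H .below (suc (suc p)) (suc q) (s<s q<p)

  det-hessenberg : ∀ {b n} {A : Matrix (suc (suc n)) (suc (suc n))} → IsHessenberg b A →
    det A ≈ A zero zero * det (minor A zero) + - b * det (minor A (suc zero))
  det-hessenberg {b} {n} {A} H = +-cong (*-identityˡ _) (begin
    (- 1#) ^ 1 * (A (suc zero) zero * d₁) + sum rest  ≈⟨ +-cong (*-cong (*-identityʳ _) (*-congʳ (H .subdiagonal zero))) (sum-zero rest≈0) ⟩
    - 1# * (b * d₁) + 0#                              ≈⟨ +-identityʳ _ ⟩
    - 1# * (b * d₁)                                   ≈⟨ -1*x≈-x _ ⟩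
    - (b * d₁)                                        ≈⟨ -‿distribˡ-* b d₁ ⟩
    - b * d₁                                          ∎)
    where
    d₁ : Carrier
    d₁ = det (minor A (suc zero))

    rest : Vector Carrier n
    rest p = (- 1#) ^ toℕ (suc (suc p)) * (A (suc (suc p)) zero * det (minor A (suc (suc p))))

    rest≈0 : ∀ p → rest p ≈ 0#
    rest≈0 p = begin
      rest p                                 ≈⟨ *-congˡ (*-congʳ (H .below (suc (suc p)) zero (s<s z<s))) ⟩
      (- 1#) ^ toℕ (suc (suc p)) * (0# * _)  ≈⟨ *-congˡ (zeroˡ _) ⟩
      (- 1#) ^ toℕ (suc (suc p)) * 0#        ≈⟨ zeroʳ _ ⟩
      0#                                     ∎

  -- From the third row on, the first column of `A` vanishes, so `x zero` drops out.
  below-first-column : ∀ {b n} {A : Matrix (suc (suc n)) (suc (suc n))} → IsHessenberg b A →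
    (x : Vector Carrier (suc (suc n))) → ∀ p →
    (A · x) (suc (suc p)) ≈ (minor A zero · tail x) (suc p)
  below-first-column H x p = begin
    _ * x zero + _   ≈⟨ +-congʳ (*-congʳ (H .below (suc (suc p)) zero (s<s z<s))) ⟩
    0# * x zero + _  ≈⟨ +-congʳ (zeroˡ _) ⟩
    0# + _           ≈⟨ +-identityˡ _ ⟩
    _                ∎

  -- Leaving row zero unconstrained lets the induction reach both minors. The second formula for
  -- `minor A zero` evaluates row one of `A` on `tail x` and so yields `x zero`; for
  -- `minor A (suc zero)` it evaluates row zero.
  hessenberg-solution : ∀ {v b} → v * - b ≈ 1# →
    ∀ {n} {A : Matrix (suc n) (suc n)} → IsHessenberg b A →
    (x : Vector Carrier (suc n)) → (∀ p → (A · x) (suc p) ≈ 0#) →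
    (x zero ≈ v ^ n * det (minor A zero) * x (fromℕ n)) ×
    ((A · x) zero ≈ v ^ n * det A * x (fromℕ n))
  hessenberg-solution v-b≈1 {zero} {A} H x Ax≈0 =
    solve 1 (λ y → y := con 1 :* con 1 :* y) refl (x zero) ,
    -- The Laplace sum for a matrix of size one, with the empty determinant `1#` and the trailing
    -- `0#` of the sum.
    solve 2 (λ a y → a :* y :+ con 0 := con 1 :* (con 1 :* (a :* con 1) :+ con 0) :* y) refl (A zero zero) (x zero)
  hessenberg-solution {v} {b} v-b≈1 {suc n} {A} H x Ax≈0 = x₀-formula , (begin
    a * x zero + (minor A (suc zero) · tail x) zero  ≈⟨ +-cong (*-congˡ x₀-formula) row₁ ⟩
    -- Inserting `v * - b` for `1#` in the second term makes `v * w`, that is `v ^ suc n`, a common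
    -- factor.
    a * (v * w * d₀ * l) + w * d₁ * l                ≈⟨ +-congˡ (*-identityˡ _) ⟨
    a * (v * w * d₀ * l) + 1# * (w * d₁ * l)         ≈⟨ +-congˡ (*-congʳ v-b≈1) ⟨
    a * (v * w * d₀ * l) + v * - b * (w * d₁ * l)    ≈⟨ solve 7 (λ a v w d₀ l c d₁ →
                                                          a :* (v :* w :* d₀ :* l) :+ v :* c :* (w :* d₁ :* l)
                                                            := v :* w :* (a :* d₀ :+ c :* d₁) :* l)
                                                          refl a v w d₀ l (- b) d₁ ⟩
    v * w * (a * d₀ + - b * d₁) * l                  ≈⟨ *-congʳ (*-congˡ (det-hessenberg H)) ⟨
    v * w * det A * l                                ∎)
    where
    a w d₀ d₁ l s : Carrier
    a = A zero zero
    w = v ^ n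
    d₀ = det (minor A zero)
    d₁ = det (minor A (suc zero))
    l = x (fromℕ (suc n))
    s = (minor A zero · tail x) zero

    -- Serves both minors: `punchIn zero` and `punchIn (suc zero)` agree on `suc p`.
    minor-annihilates : ∀ p → (minor A zero · tail x) (suc p) ≈ 0#
    minor-annihilates p = trans (sym (below-first-column H x p)) (Ax≈0 (suc p))

    row₀ : s ≈ w * d₀ * l
    row₀ = proj₂ (hessenberg-solution v-b≈1 (minor₀-isHessenberg H) (tail x) minor-annihilates)

    row₁ : (minor A (suc zero) · tail x) zero ≈ w * d₁ * l
    row₁ = proj₂ (hessenberg-solution v-b≈1 (minor₁-isHessenberg H) (tail x) minor-annihilates)

    x₀-formula : x zero ≈ v * w * d₀ * l
    x₀-formula = begin
      x zero              ≈⟨ *-identityˡ _ ⟨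
      1# * x zero         ≈⟨ *-congʳ v-b≈1 ⟨
      v * - b * x zero    ≈⟨ *-assoc v (- b) (x zero) ⟩
      v * (- b * x zero)  ≈⟨ *-congˡ (-‿distribˡ-* b (x zero)) ⟨
      -- Row one of `A · x` is `b * x zero + s`; as it vanishes, `s` is the negative of
      -- `b * x zero`.
      v * - (b * x zero)  ≈⟨ *-congˡ (+-inverseʳ-unique (b * x zero) s
                               (trans (+-congʳ (*-congʳ (sym (H .subdiagonal zero)))) (Ax≈0 zero))) ⟨
      v * s               ≈⟨ *-congˡ row₀ ⟩
      v * (w * d₀ * l)    ≈⟨ solve 4 (λ v w d l → v :* (w :* d :* l) := v :* w :* d :* l) refl v w d₀ l ⟩
      v * w * d₀ * l      ∎

  -- Eigenvectors and the matrix `A - μI`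

  I-identity : ∀ {n} (x : Vector Carrier n) p → (I · x) p ≈ x p
  I-identity x zero = begin
    1# * x zero + sum (λ q → 0# * x (suc q))  ≈⟨ +-cong (*-identityˡ _) (sum-zero (λ q → zeroˡ (x (suc q)))) ⟩
    x zero + 0#                               ≈⟨ +-identityʳ _ ⟩
    x zero                                    ∎
  I-identity x (suc p) = begin
    0# * x zero + (I · tail x) p  ≈⟨ +-cong (zeroˡ _) (I-identity (tail x) p) ⟩
    0# + x (suc p)                ≈⟨ +-identityˡ _ ⟩
    x (suc p)                     ∎

  shifted : ∀ {n} → Matrix n n → Carrier → Matrix n n
  shifted A μ p q = A p q - μ * I p q

  shifted-annihilates : ∀ {n} (A : Matrix n n) μ x → IsEigenvector A μ x →
                        ∀ p → (shifted A μ · x) p ≈ 0#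
  shifted-annihilates A μ x (_ , Ax≈μx) p = begin
    sum (λ q → (A p q - μ * I p q) * x q)                ≈⟨ sum-cong-≋ split ⟩
    sum (λ q → A p q * x q + - μ * (I p q * x q))        ≈⟨ ∑-distrib-+ (λ q → A p q * x q) (λ q → - μ * (I p q * x q)) ⟩
    (A · x) p + sum (λ q → - μ * (I p q * x q))          ≈⟨ +-cong (Ax≈μx p) (sym (*-distribˡ-sum (- μ) (λ q → I p q * x q))) ⟩
    μ * x p + - μ * (I · x) p                            ≈⟨ +-congˡ (*-congˡ (I-identity x p)) ⟩
    μ * x p + - μ * x p                                  ≈⟨ distribʳ (x p) μ (- μ) ⟨
    (μ - μ) * x p                                        ≈⟨ *-congʳ (-‿inverseʳ μ) ⟩
    0# * x p                                             ≈⟨ zeroˡ (x p) ⟩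
    0#                                                   ∎
    where
    split : ∀ q → (A p q - μ * I p q) * x q ≈ A p q * x q + - μ * (I p q * x q)
    split q = begin
      (A p q - μ * I p q) * x q            ≈⟨ *-congʳ (+-congˡ (-‿distribˡ-* μ (I p q))) ⟩
      (A p q + - μ * I p q) * x q          ≈⟨ distribʳ (x q) (A p q) (- μ * I p q) ⟩
      A p q * x q + - μ * I p q * x q      ≈⟨ +-congˡ (*-assoc (- μ) (I p q) (x q)) ⟩
      A p q * x q + - μ * (I p q * x q)    ∎

  -- The matrices Gₙ

  G-toeplitz : ∀ n p q → G (suc n) (suc p) (suc q) ≡ G n p q
  -- The Boolean test behind `≤?` reduces only once `p` is known to be zero or a successor.
  G-toeplitz n zero    q = ≡.refl
  G-toeplitz n (suc p) q = ≡.refl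

  shifted-G-toeplitz : ∀ μ n p q → shifted (G (suc n)) μ (suc p) (suc q) ≈ shifted (G n) μ p q
  shifted-G-toeplitz μ n p q = +-congʳ (reflexive (G-toeplitz n p q))

  -- Off the diagonal, subtracting `μ * I p q` changes nothing.
  x-y*0≈x : ∀ x y → x - y * 0# ≈ x
  x-y*0≈x x y = begin
    x - y * 0#  ≈⟨ +-congˡ (-‿cong (zeroʳ y)) ⟩
    x - 0#      ≈⟨ +-congˡ -0#≈0# ⟩
    x + 0#      ≈⟨ +-identityʳ x ⟩
    x           ∎

  -- The Toeplitz property moves an entry up its diagonal to the first column, where its value can
  -- be read off.
  shifted-G-isHessenberg : ∀ μ n → IsHessenberg 2# (shifted (G (suc n)) μ)
  shifted-G-isHessenberg μ (suc n) .subdiagonal zero    = x-y*0≈x 2# μ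
  shifted-G-isHessenberg μ (suc n) .subdiagonal (suc p) =
    trans (shifted-G-toeplitz μ (suc n) (suc p) (inject₁ p)) (shifted-G-isHessenberg μ n .subdiagonal p)
  shifted-G-isHessenberg μ n .below (suc (suc p)) zero q<p = x-y*0≈x 0# μ
  shifted-G-isHessenberg μ (suc n) .below (suc p) (suc q) (s<s q<p) =
    trans (shifted-G-toeplitz μ (suc n) p q) (shifted-G-isHessenberg μ n .below p q q<p)

  -- Induction drops leading entries until `i` indexes the first one. The hypothesis concerns only
  -- rows below the first because that is what passes to `tail x`, which need not be an eigenvector
  -- of the smaller matrix.
  coord-charPoly : ∀ {v} → v * - 2# ≈ 1# → ∀ μ n (x : Vector Carrier (suc n)) →
    (∀ p → (shifted (G (suc n)) μ · x) (suc p) ≈ 0#) →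
    ∀ i (i<1+n : i <ℕ suc n) → coord x i i<1+n ≈ v ^ i * charPoly (G i) μ * x (fromℕ n)
  coord-charPoly {v} v-2≈1 μ n x Ax≈0 i i<1+n with m<1+n⇒m<n∨m≡n i<1+n
  ... | inj₂ ≡.refl = begin
    x (opposite (fromℕ< i<1+n))                                     ≡⟨ ≡.cong x (opposite-fromℕ<-max i<1+n) ⟩
    x zero                                                          ≈⟨ proj₁ (hessenberg-solution v-2≈1 (shifted-G-isHessenberg μ n) x Ax≈0) ⟩
    v ^ n * det (minor (shifted (G (suc n)) μ) zero) * x (fromℕ n)  ≈⟨ *-congʳ (*-congˡ (det-cong (shifted-G-toeplitz μ n))) ⟩
    v ^ n * charPoly (G n) μ * x (fromℕ n)                          ∎
  coord-charPoly {v} v-2≈1 μ (suc n) x Ax≈0 i i<2+n | inj₁ i<1+n = begin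
    x (opposite (fromℕ< i<2+n))                   ≡⟨ ≡.cong x (opposite-fromℕ<-suc i<1+n i<2+n) ⟩
    coord (tail x) i i<1+n                        ≈⟨ coord-charPoly v-2≈1 μ n (tail x) tail-annihilated i i<1+n ⟩
    v ^ i * charPoly (G i) μ * x (fromℕ (suc n))  ∎
    where
    tail-annihilated : ∀ p → (shifted (G (suc n)) μ · tail x) (suc p) ≈ 0#
    tail-annihilated p = begin
      (shifted (G (suc n)) μ · tail x) (suc p)                     ≈⟨ sum-cong-≋ (λ q → *-congʳ {tail x q} (shifted-G-toeplitz μ (suc n) (suc p) q)) ⟨
      (minor (shifted (G (suc (suc n))) μ) zero · tail x) (suc p)  ≈⟨ below-first-column (shifted-G-isHessenberg μ (suc n)) x p ⟨
      (shifted (G (suc (suc n))) μ · x) (suc (suc p))              ≈⟨ Ax≈0 (suc p) ⟩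
      0#                                                           ∎

  -½*-2≈1 : (2#0 : 2# # 0#) → - ½ 2#0 * - 2# ≈ 1#
  -½*-2≈1 2#0 = begin
    - ½ 2#0 * - 2#      ≈⟨ -‿distribˡ-* (½ 2#0) (- 2#) ⟨
    - (½ 2#0 * - 2#)    ≈⟨ -‿cong (-‿distribʳ-* (½ 2#0) 2#) ⟨
    - - (½ 2#0 * 2#)    ≈⟨ -‿involutive _ ⟩
    ½ 2#0 * 2#          ≈⟨ *-congˡ (trans (+-congˡ -0#≈0#) (+-identityʳ 2#)) ⟨
    ½ 2#0 * (2# - 0#)   ≈⟨ proj₁ (proj₂ (#⇒invertible 2#0)) ⟩
    1#                  ∎

corollary4 : ∀ {c ℓ₁ ℓ₂ : Level} (K : HeytingField c ℓ₁ ℓ₂) →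
    let open HeytingField K
        open Matrices K
    in
    (2#0 : 2# # 0#) →
    (n : ℕ) → 2 ≤ℕ n →
    (μ : Carrier) (x : Vector Carrier n) → IsEigenvector (G n) μ x →
    (i : ℕ) → 1 ≤ℕ i → (i<n : i <ℕ n) →
    coord x i i<n ≈ ((- ½ 2#0) ^ i) * charPoly (G i) μ * coord x 0 (≤-<-trans z≤n i<n)
-- `coord x 0` reduces to `x (fromℕ n)`, and composing with `suc` selects the rows below the first.
corollary4 K 2#0 (suc n) _ μ x eigen i _ i<n =
  coord-charPoly K (-½*-2≈1 K 2#0) μ n x (shifted-annihilates K (Matrices.G K (suc n)) μ x eigen ∘ suc) i i<n
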